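{- Let $(W,S)$ be an arbitrary Coxeter system and let $\omega=(\omega_1,\dots,\omega_m)$ be a finite word in the generators $S$. The collection of index sets of $\omega$-sorted words, $$\mathscr{F}:=\{I(\alpha)\subseteq I(\omega):\alpha\subseteq\omega\text{ is }\omega\text{ -sorted}\},$$ is a supersolvable antimatroid with respect to the natural order on the ground set $E:=I(\omega)=\{1,\dots,m\}$.
   Context: $\ell$ denotes the length function of $(W,S)$. A subword $\alpha\subseteq\omega$ is identified with its index set $I(\alpha)=\{i_1<\dots<i_k\}\subseteq I(\omega)=\{1,\dots,m\}$, with $\alpha=(\omega_{i_1},\dots,\omega_{i_k})$; two subwords are equal when their index sets are equal. For a word $\alpha=(\alpha_1,\dots,\alpha_k)$ in $S$ write $\langle\alpha\rangle=\alpha_1\cdots\alpha_k\in W$; $\alpha$ is reduced if $k=\ell(\langle\alpha\rangle)$. For $A,B\subseteq I(\omega)$, $A\leq_{\mathsf{lex}}B$ means $A=B$ or $\min((A\cup B)\setminus(A\cap B))\in A$. A subword $\alpha\subseteq\omega$ is $\omega$-sorted if it is reduced and $I(\alpha)=\min_{\leq_{\mathsf{lex}}}\{I(\beta)\subseteq I(\omega):\beta\text{ is reduced and }\langle\beta\rangle=\langle\alpha\rangle\}$. For a totally ordered set $(E,\leq_E)$ and $\mathscr{F}\subseteq 2^E$ (the feasible sets), $(E,\mathscr{F},\leq_E)$ is a supersolvable antimatroid if $\emptyset\in\mathscr{F}$ and for all $A,B\in\mathscr{F}$ with $B\not\subseteq A$, setting $x=\min_{\leq_E}(B\setminus A)$,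 one has $A\cup\{x\}\in\mathscr{F}$. -}

module Defs where

open import Algebra.Bundles using (Group)
open import Data.Bool.Base using (true; false)
open import Data.Fin.Base as Fin using (Fin)
open import Data.Fin.Subset using (Subset; _∈_; _⊈_; _∪_; _∩_; _─_; ⁅_⁆; ⊥)
open import Data.List.Base using (List; []; _∷_; _++_; length; foldr; map; concat; replicate)
open import Data.Nat.Base as ℕ using (ℕ)
open import Data.Product.Base using (∃; ∃-syntax; _×_; _,_)
open import Data.Sign.Base as Sign using (Sign; opposite)
open import Data.Sum.Base using (_⊎_)
open import Data.Vec.Base using (Vec; []; _∷_)
open import Function.Bundles using (_⇔_)
open import Level using (Level; _⊔_; suc)
open import Relation.Binary.Core using (Rel)
open import Relation.Binary.Construct.Closure.Equivalence using (EqClosure)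
open import Relation.Binary.PropositionalEquality.Core using (_≡_; _≢_)
open import Relation.Binary.Structures using (IsTotalOrder)
open import Relation.Nullary.Construct.Add.Supremum using (_⁺; [_])
open import Relation.Unary using (Pred)

private
  variable
    a c ℓ p r : Level

IsLeast : {A : Set a} → Rel A ℓ → Pred A p → Pred A (a ⊔ ℓ ⊔ p)
IsLeast _≤_ P x = P x × (∀ y → P y → x ≤ y)

------------------------------------------------------------------------
-- Group presentations

-- (+ , s) stands for the generator s, (- , s) for its formal inverse.
GroupWord : Set a → Set a
GroupWord S = List (Sign × S)

-- Words modulo _∼_ form the quotient of the free group on S by the
-- normal closure of the relators R.
module Presentation {S : Set a} (R : Pred (GroupWord S) r) where

  data Trivial : Pred (GroupWord S) (a ⊔ r) where
    cancel  : ∀ x s → Trivial ((x , s) ∷ (opposite x , s) ∷ [])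
    relator : ∀ {u} → R u → Trivial u

  data _⟶_ : Rel (GroupWord S) (a ⊔ r) where
    delete : ∀ u {t} v → Trivial t → (u ++ t ++ v) ⟶ (u ++ v)

  _∼_ : Rel (GroupWord S) (a ⊔ r)
  _∼_ = EqClosure _⟶_

module _ {S : Set a} (W : Group c ℓ) (σ : S → Group.Carrier W) where
  open Group W

  evalLetter : Sign × S → Carrier
  evalLetter (Sign.+ , s) = σ s
  evalLetter (Sign.- , s) = σ s ⁻¹

  eval : GroupWord S → Carrier
  eval u = foldr _∙_ ε (map evalLetter u)

  -- W = ⟨ S | R ⟩ via σ: evaluation induces an isomorphism onto W from
  -- the group of words modulo _∼_.
  record IsPresentedBy (R : Pred (GroupWord S) r) : Set (a ⊔ c ⊔ ℓ ⊔ r) where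
    open Presentation R
    field
      generates : ∀ w → ∃[ u ] eval u ≈ w
      presents  : ∀ u v → (eval u ≈ eval v) ⇔ (u ∼ v)

------------------------------------------------------------------------
-- Coxeter systems

-- Entries lie in ℕ with an added top element, which plays the role of ∞.
record IsCoxeterMatrix {S : Set a} (m : S → S → ℕ ⁺) : Set a where
  field
    symmetric : ∀ s t → m s t ≡ m t s
    positive  : ∀ s t → m s t ≢ [ 0 ]
    diagonal  : ∀ s t → (m s t ≡ [ 1 ]) ⇔ (s ≡ t)

-- The relators (st)^m(s,t) for m(s,t) finite.
data CoxeterRelator {S : Set a} (m : S → S → ℕ ⁺) : Pred (GroupWord S) a where
  power : ∀ s t {k} → m s t ≡ [ k ] →
          CoxeterRelator m
            (concat (replicate k ((Sign.+ , s) ∷ (Sign.+ , t) ∷ [])))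

-- That σ is injective follows from the other fields.
record CoxeterSystem a c ℓ : Set (suc (a ⊔ c ⊔ ℓ)) where
  field
    W               : Group c ℓ
    S               : Set a
    σ               : S → Group.Carrier W
    m               : S → S → ℕ ⁺
    isCoxeterMatrix : IsCoxeterMatrix m
    isPresentedBy   : IsPresentedBy W σ (CoxeterRelator m)

------------------------------------------------------------------------
-- Subwords, identified with their index sets

subword : {S : Set a} → ∀ {n} → Vec S n → Subset n → List S
subword []      []          = []
subword (s ∷ ω) (true  ∷ A) = s ∷ subword ω A
subword (s ∷ ω) (false ∷ A) = subword ω A

_≤lex_ : ∀ {n} → Rel (Subset n) _
A ≤lex B =
  A ≡ B ⊎ (∃[ i ] IsLeast Fin._≤_ (_∈ ((A ∪ B) ─ (A ∩ B))) i × i ∈ A)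

module _ (C : CoxeterSystem a c ℓ) where
  open CoxeterSystem C
  open Group W

  ⟨_⟩ : List S → Carrier
  ⟨ α ⟩ = foldr _∙_ ε (map σ α)

  -- The graph of the length function. As σ s is an involution, inverses
  -- of generators need not be allowed.
  HasLength : Carrier → ℕ → Set (a ⊔ ℓ)
  HasLength w =
    IsLeast ℕ._≤_ (λ k → ∃[ α ] (length α ≡ k × ⟨ α ⟩ ≈ w))

  Reduced : Pred (List S) (a ⊔ ℓ)
  Reduced α = HasLength ⟨ α ⟩ (length α)

  Sorted : ∀ {n} → Vec S n → Pred (Subset n) (a ⊔ ℓ)
  Sorted ω A =
    Reduced (subword ω A) ×
    IsLeast _≤lex_
      (λ B → Reduced (subword ω B) × ⟨ subword ω B ⟩ ≈ ⟨ subword ω A ⟩) A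

------------------------------------------------------------------------
-- Supersolvable antimatroids on the ground set Fin n

record IsSupersolvableAntimatroid
         {n} (_≤_ : Rel (Fin n) ℓ) (F : Pred (Subset n) p) : Set (ℓ ⊔ p) where
  field
    isTotalOrder : IsTotalOrder _≡_ _≤_
    ∅-feasible   : F ⊥
    extension    : ∀ {A B} → F A → F B → B ⊈ A →
                   ∃[ x ] (IsLeast _≤_ (_∈ (B ─ A)) x × F (A ∪ ⁅ x ⁆))

{-# OPTIONS --safe #-}
module Submission where

-- By the exchange condition, a subword A of ω = (ω₁, …, ωₘ) is sorted if
-- and only if, for every i (in A or not), the word ωᵢ followed by the
-- letters of A after position i is reduced. Sorted subwords in this local
-- description are closed under truncation and under union; since A ∪ {x}
-- is A ∪ (B ∩ {1, …, x}), this gives the extension property.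
--
-- The union is built one letter at a time, by means of the following
-- consequence of the strong exchange condition: if r u s, r u v and u s v
-- are reduced, then so is r u s v.
--
-- Strong exchange comes from the parity of the number of times that a
-- reflection occurs in a word, which does not change under the Coxeter
-- relations. Equality in W is not assumed to be decidable, so these
-- parities exist only up to double negation; this suffices because being
-- reduced is a ¬¬-stable property.

open import Level using (Level; _⊔_)
open import Algebra.Bundles using (Group)
import Algebra.Properties.Group as GroupProperties
open import Data.Bool.Base using (Bool; true; false; not; _xor_; _∨_; if_then_else_)
import Data.Bool.Properties as Boolₚ
open import Data.Empty using (⊥-elim)
open import Data.Fin.Base as Fin using (Fin; zero; suc)
import Data.Fin.Properties as Finₚ
open import Data.Fin.Subset using (Subset; _∈_; _⊈_; _∪_; _∩_; _─_; ⁅_⁆; ⊥)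
import Data.Fin.Subset.Properties as Subsetₚ
open import Data.List.Base
  using (List; []; _∷_; _++_; _∷ʳ_; map; length; concat; replicate)
open import Data.List.Properties
  using (++-assoc; ++-identityʳ; length-++; length-map; map-++; map-∘; map-id)
open import Data.List.Relation.Unary.All using (All; []; _∷_)
open import Data.List.Reverse using (Reverse; []; _∶_∶ʳ_; reverseView)
open import Data.Nat.Base using (ℕ; zero; suc; _+_; _*_; z≤n; s≤s)
import Data.Nat.Properties as ℕₚ
open import Data.Product.Base using (∃-syntax; _×_; _,_; proj₂)
open import Data.Sign.Base as Sign using (Sign)
open import Data.Sum.Base using (_⊎_; inj₁; inj₂)
open import Data.Unit.Polymorphic.Base using (⊤; tt)
open import Data.Vec.Base as Vec using (Vec; []; _∷_; here; there)
import Data.Vec.Properties as Vecₚ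
open import Function.Base using (_∘_; id; flip; case_of_)
open import Function.Bundles using (_⇔_; mk⇔; Equivalence)
open import Relation.Binary.Construct.Closure.Equivalence using (fold; return)
open import Relation.Binary.PropositionalEquality as ≡ using (_≡_; refl)
import Relation.Binary.Reasoning.Setoid as SetoidReasoning
open import Relation.Nullary
  using (¬_; Dec; yes; no; does; contradiction; decidable-stable; ¬¬-excluded-middle)
open import Relation.Nullary.Construct.Add.Supremum using ([_])
open import Relation.Nullary.Decidable using (does-⇔; dec-true)
open import Relation.Unary using (Pred)
open import Defs

private
  variable
    a c ℓ r : Level
    n : ℕ

-- Unions of greedy subwords, from closure properties of reduced words.

module GreedyUnion {S : Set a} (Red : Pred (List S) r)
  (empty  : Red [])
  (prefix : ∀ u {v} → Red (u ++ v) → Red u)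
  (suffix : ∀ s {u} → Red (s ∷ u) → Red u)
  (insert : ∀ r u s v → Red (r ∷ u ∷ʳ s) → Red (r ∷ u ++ v) →
            Red (u ++ s ∷ v) → Red (r ∷ u ++ s ∷ v))
  where
  open ≡ using (subst; cong; sym; trans; module ≡-Reasoning)
  open import Data.Nat.Base using (_≤_)

  -- A word together with two of its subwords.
  Marked : Set a
  Marked = List (S × Bool × Bool)

  Choice : Set
  Choice = Bool → Bool → Bool

  left right : Choice
  left  x y = x
  right x y = y

  select : Choice → Marked → List S
  select f []                = []
  select f ((s , x , y) ∷ l) = if f x y then s ∷ select f l else select f l

  -- The letter `s` is put in front whether or not `f` selects it: this is the local form of
  -- sortedness. With `f` as a parameter, both subwords and their union live on one list.
  Greedy : Choice → Marked → Set r
  Greedy f []                = ⊤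
  Greedy f ((s , _ , _) ∷ l) = Red (s ∷ select f l) × Greedy f l

  select-++ : ∀ f k l → select f (k ++ l) ≡ select f k ++ select f l
  select-++ f []                l = refl
  select-++ f ((s , x , y) ∷ k) l with f x y
  ... | true  = cong (s ∷_) (select-++ f k l)
  ... | false = select-++ f k l

  Greedy-prefix : ∀ f k {l} → Greedy f (k ++ l) → Greedy f k
  Greedy-prefix f []                g       = tt
  Greedy-prefix f ((s , _ , _) ∷ k) {l} (p , g) =
    prefix (s ∷ select f k) (subst (Red ∘ (s ∷_)) (select-++ f k l) p) ,
    Greedy-prefix f k g

  Greedy⇒Red : ∀ f l → Greedy f l → Red (select f l)
  Greedy⇒Red f []                g       = empty
  Greedy⇒Red f ((s , x , y) ∷ l) (p , g) with f x y
  ... | true  = p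
  ... | false = suffix s p

  swap : Marked → Marked
  swap = map λ (s , x , y) → s , y , x

  select-swap : ∀ f l → select f (swap l) ≡ select (flip f) l
  select-swap f []                = refl
  select-swap f ((s , x , y) ∷ l) with f y x
  ... | true  = cong (s ∷_) (select-swap f l)
  ... | false = select-swap f l

  select-∨-swap : ∀ l → select _∨_ (swap l) ≡ select _∨_ l
  select-∨-swap []                = refl
  select-∨-swap ((s , x , y) ∷ l) rewrite Boolₚ.∨-comm y x | select-∨-swap l = refl

  Greedy-swap : ∀ f l → Greedy (flip f) l → Greedy f (swap l)
  Greedy-swap f []                g       = tt
  Greedy-swap f ((s , _ , _) ∷ l) (p , g) =
    subst (Red ∘ (s ∷_)) (sym (select-swap f l)) p , Greedy-swap f l g

  -- Clearing the second marks of a tail turns the union into a hybrid word: the union up to the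
  -- cut, the first subword alone beyond it. Both subwords stay greedy, so an induction hypothesis
  -- on unions also covers hybrids.
  clearʳ : Marked → Marked
  clearʳ = map λ (s , x , _) → s , x , false

  select-left-clearʳ : ∀ l → select left (clearʳ l) ≡ select left l
  select-left-clearʳ []                    = refl
  select-left-clearʳ ((s , true  , _) ∷ l) = cong (s ∷_) (select-left-clearʳ l)
  select-left-clearʳ ((s , false , _) ∷ l) = select-left-clearʳ l

  select-right-clearʳ : ∀ l → select right (clearʳ l) ≡ []
  select-right-clearʳ []      = refl
  select-right-clearʳ (_ ∷ l) = select-right-clearʳ l

  select-∨-clearʳ : ∀ l → select _∨_ (clearʳ l) ≡ select left l
  select-∨-clearʳ []                    = refl
  select-∨-clearʳ ((s , true  , _) ∷ l) = cong (s ∷_) (select-∨-clearʳ l)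
  select-∨-clearʳ ((s , false , _) ∷ l) = select-∨-clearʳ l

  Greedy-left-clearʳ : ∀ k l → Greedy left (k ++ l) → Greedy left (k ++ clearʳ l)
  Greedy-left-clearʳ [] []                g       = tt
  Greedy-left-clearʳ [] ((s , _ , _) ∷ l) (p , g) =
    subst (Red ∘ (s ∷_)) (sym (select-left-clearʳ l)) p ,
    Greedy-left-clearʳ [] l g
  Greedy-left-clearʳ ((s , _ , _) ∷ k) l (p , g) =
    subst (Red ∘ (s ∷_)) eq p , Greedy-left-clearʳ k l g
    where
    eq : select left (k ++ l) ≡ select left (k ++ clearʳ l)
    eq = begin
      select left (k ++ l)                   ≡⟨ select-++ left k l ⟩
      select left k ++ select left l         ≡⟨ cong (select left k ++_) (select-left-clearʳ l) ⟨
      select left k ++ select left (clearʳ l) ≡⟨ select-++ left k (clearʳ l) ⟨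
      select left (k ++ clearʳ l)            ∎
      where open ≡-Reasoning

  Greedy-right-clearʳ : ∀ k l → Greedy right (k ++ l) → Greedy right (k ++ clearʳ l)
  Greedy-right-clearʳ [] []                g       = tt
  Greedy-right-clearʳ [] ((s , _ , _) ∷ l) (p , g) =
    -- Nothing is selected beyond the cut, so the single letter `s` is all that remains.
    subst (Red ∘ (s ∷_)) (sym (select-right-clearʳ l)) (prefix (s ∷ []) p) ,
    Greedy-right-clearʳ [] l g
  Greedy-right-clearʳ ((s , _ , _) ∷ k) l (p , g) =
    subst (Red ∘ (s ∷_)) eq
      (prefix (s ∷ select right k) (subst (Red ∘ (s ∷_)) (select-++ right k l) p)) ,
    Greedy-right-clearʳ k l g
    where
    eq : select right k ≡ select right (k ++ clearʳ l)
    eq = begin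
      select right k                            ≡⟨ ++-identityʳ _ ⟨
      select right k ++ []                      ≡⟨ cong (select right k ++_) (select-right-clearʳ l) ⟨
      select right k ++ select right (clearʳ l) ≡⟨ select-++ right k (clearʳ l) ⟨
      select right (k ++ clearʳ l)              ∎
      where open ≡-Reasoning

  -- Adds the letters of the second subword to the first one by one, from
  -- the left; w is the part of the union that has been completed.
  fill : ∀ r w q z →
         Red (r ∷ w ++ select _∨_ q) →
         (∀ k l → q ≡ k ++ l → Red (w ++ select _∨_ k ++ select left l ∷ʳ z)) →
         Red (r ∷ w ++ select left q ∷ʳ z) →
         Red (r ∷ w ++ select _∨_ q ∷ʳ z)
  fill r w [] z union hybrid start = start
  fill r w ((s , false , false) ∷ q) z union hybrid start =
    fill r w q z union (λ k l eq → hybrid ((s , false , false) ∷ k) l (cong (_ ∷_) eq)) start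
  fill r w ((s , true , y) ∷ q) z union hybrid start =
    subst (Red ∘ (r ∷_)) (++-assoc w (s ∷ []) _)
      (fill r (w ∷ʳ s) q z
        (subst (Red ∘ (r ∷_)) (sym (++-assoc w (s ∷ []) _)) union)
        (λ k l eq → subst Red (sym (++-assoc w (s ∷ []) _))
          (hybrid ((s , true , y) ∷ k) l (cong (_ ∷_) eq)))
        (subst (Red ∘ (r ∷_)) (sym (++-assoc w (s ∷ []) _)) start))
  fill r w ((s , false , true) ∷ q) z union hybrid start =
    subst (Red ∘ (r ∷_)) (++-assoc w (s ∷ []) _)
      (fill r (w ∷ʳ s) q z union′
        (λ k l eq → subst Red (sym (++-assoc w (s ∷ []) _))
          (hybrid ((s , false , true) ∷ k) l (cong (_ ∷_) eq)))
        (subst (Red ∘ (r ∷_)) (sym (++-assoc w (s ∷ []) _))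
          -- The three reduced words come from a prefix of the union, from the word built so far,
          -- and from the hybrid cut just after `s`.
          (insert r w s (select left q ∷ʳ z)
            (prefix (r ∷ w ∷ʳ s) union′)
            start
            (hybrid ((s , false , true) ∷ []) q refl))))
    where
    union′ : Red (r ∷ (w ∷ʳ s) ++ select _∨_ q)
    union′ = subst (Red ∘ (r ∷_)) (sym (++-assoc w (s ∷ []) _)) union

  -- The bound is on length because the induction hypothesis is applied to lists with cleared tails,
  -- which are not structural parts of the given list.
  UnionClosed : ℕ → Set _
  UnionClosed n = ∀ l → length l ≤ n →
                  Greedy left l → Greedy right l → Greedy _∨_ l

  -- Treats a last letter `z` that belongs to the first subword. Each hybrid required by `fill` is
  -- the union of the first subword with the second one cut off after `k`; it has no `r` in front,
  -- so `closed` applies to it.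
  fill-last : ∀ {n} → UnionClosed n →
              ∀ r q z y → length (q ∷ʳ (z , true , y)) ≤ n →
              Greedy left (q ∷ʳ (z , true , y)) →
              Greedy right (q ∷ʳ (z , true , y)) →
              Red (r ∷ select left (q ∷ʳ (z , true , y))) →
              Red (r ∷ select _∨_ q) →
              Red (r ∷ select _∨_ (q ∷ʳ (z , true , y)))
  fill-last {n} closed r q z y q≤n gˡ gʳ start union =
    subst (Red ∘ (r ∷_)) (sym (select-++ _∨_ q _))
      (fill r [] q z union hybrid
        (subst (Red ∘ (r ∷_)) (select-++ left q _) start))
    where
    hybrid : ∀ k l → q ≡ k ++ l → Red (select _∨_ k ++ select left l ∷ʳ z)
    hybrid k l refl = subst Red eq (Greedy⇒Red _∨_ (k ++ clearʳ l′) (closed (k ++ clearʳ l′) len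
        (Greedy-left-clearʳ k l′ (subst (Greedy left) assoc gˡ))
        (Greedy-right-clearʳ k l′ (subst (Greedy right) assoc gʳ))))
      where
      l′ : Marked
      l′ = l ∷ʳ (z , true , y)

      assoc : (k ++ l) ∷ʳ (z , true , y) ≡ k ++ l′
      assoc = ++-assoc k l _

      len : length (k ++ clearʳ l′) ≤ n
      len = subst (_≤ n) (begin
        length ((k ++ l) ∷ʳ (z , true , y)) ≡⟨ cong length assoc ⟩
        length (k ++ l′)                    ≡⟨ length-++ k ⟩
        length k + length l′                ≡⟨ cong (length k +_) (length-map _ l′) ⟨
        length k + length (clearʳ l′)       ≡⟨ length-++ k ⟨
        length (k ++ clearʳ l′)             ∎) q≤n
        where open ≡-Reasoning

      eq : select _∨_ (k ++ clearʳ l′) ≡ select _∨_ k ++ select left l ∷ʳ z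
      eq = begin
        select _∨_ (k ++ clearʳ l′)             ≡⟨ select-++ _∨_ k (clearʳ l′) ⟩
        select _∨_ k ++ select _∨_ (clearʳ l′)  ≡⟨ cong (select _∨_ k ++_) (select-∨-clearʳ l′) ⟩
        select _∨_ k ++ select left l′          ≡⟨ cong (select _∨_ k ++_) (select-++ left l _) ⟩
        select _∨_ k ++ select left l ∷ʳ z      ∎
        where open ≡-Reasoning

  -- Induction from the right end, with `r` kept in front. A last letter in neither subword changes
  -- nothing, one in the first is handled by `fill-last`, and one only in the second by `fill-last`
  -- with the two subwords exchanged.
  Red-union : ∀ {n} → UnionClosed n →
              ∀ r {l} → Reverse l → length l ≤ n →
              Greedy left l → Greedy right l →
              Red (r ∷ select left l) → Red (r ∷ select right l) →
              Red (r ∷ select _∨_ l)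
  Red-union closed r [] l≤n gˡ gʳ pˡ pʳ = pˡ
  Red-union {n} closed r (q ∶ rq ∶ʳ (z , x , y)) l≤n gˡ gʳ pˡ pʳ = last x y l≤n gˡ gʳ pˡ pʳ
    where
    union : Red (r ∷ select _∨_ q)
    union = Red-union closed r rq
      (ℕₚ.≤-trans (ℕₚ.m≤m+n _ 1) (subst (_≤ n) (length-++ q) l≤n))
      (Greedy-prefix left q gˡ) (Greedy-prefix right q gʳ)
      (prefix (r ∷ select left q) (subst (Red ∘ (r ∷_)) (select-++ left q _) pˡ))
      (prefix (r ∷ select right q) (subst (Red ∘ (r ∷_)) (select-++ right q _) pʳ))

    last : ∀ x y → length (q ∷ʳ (z , x , y)) ≤ n →
           Greedy left (q ∷ʳ (z , x , y)) → Greedy right (q ∷ʳ (z , x , y)) →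
           Red (r ∷ select left (q ∷ʳ (z , x , y))) →
           Red (r ∷ select right (q ∷ʳ (z , x , y))) →
           Red (r ∷ select _∨_ (q ∷ʳ (z , x , y)))
    last false false l≤n gˡ gʳ pˡ pʳ =
      subst (Red ∘ (r ∷_))
        (sym (trans (select-++ _∨_ q _) (++-identityʳ _))) union
    last true  y     l≤n gˡ gʳ pˡ pʳ = fill-last closed r q z y l≤n gˡ gʳ pˡ union
    last false true  l≤n gˡ gʳ pˡ pʳ =
      subst (Red ∘ (r ∷_)) (select-∨-swap l)
        (subst (Red ∘ (r ∷_) ∘ select _∨_) (sym eq)
          (fill-last closed r (swap q) z false
            (subst (_≤ n) (trans (sym (length-map _ l)) (cong length eq)) l≤n)
            (subst (Greedy left) eq (Greedy-swap left l gʳ))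
            (subst (Greedy right) eq (Greedy-swap right l gˡ))
            (subst (Red ∘ (r ∷_) ∘ select left) eq
              (subst (Red ∘ (r ∷_)) (sym (select-swap left l)) pʳ))
            (subst (Red ∘ (r ∷_)) (sym (select-∨-swap q)) union)))
      where
      l : Marked
      l = q ∷ʳ (z , false , true)

      eq : swap l ≡ swap q ∷ʳ (z , true , false)
      eq = map-++ _ q _

  union-closed : ∀ n → UnionClosed n
  union-closed n       []                l≤n       gˡ       gʳ       = tt
  union-closed (suc n) ((s , _ , _) ∷ l) (s≤s l≤n) (pˡ , gˡ) (pʳ , gʳ) =
    Red-union (union-closed n) s (reverseView l) l≤n gˡ gʳ pˡ pʳ ,
    union-closed n l l≤n gˡ gʳ

-- Deletion of one letter from a word.

data Deletion {A : Set a} : List A → List A → Set a where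
  here  : ∀ {x u} → Deletion u (x ∷ u)
  there : ∀ {x u v} → Deletion u v → Deletion (x ∷ u) (x ∷ v)

module _ {A : Set a} where

  Deletion-length : ∀ {u v : List A} → Deletion u v → suc (length u) ≡ length v
  Deletion-length here      = refl
  Deletion-length (there d) = ≡.cong suc (Deletion-length d)

  Deletion-∷ʳ : ∀ (w : List A) {z u} → Deletion u (w ∷ʳ z) →
                u ≡ w ⊎ ∃[ v ] (u ≡ v ∷ʳ z × Deletion v w)
  Deletion-∷ʳ []      here      = inj₁ refl
  Deletion-∷ʳ (x ∷ w) here      = inj₂ (w , refl , here)
  Deletion-∷ʳ (x ∷ w) (there d) with Deletion-∷ʳ w d
  ... | inj₁ refl            = inj₁ refl
  ... | inj₂ (v , refl , d′) = inj₂ (x ∷ v , refl , there d′)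

  Deletion-insert : ∀ (u : List A) {x v} → Deletion (u ++ v) (u ++ x ∷ v)
  Deletion-insert []      = here
  Deletion-insert (y ∷ u) = there (Deletion-insert u)

  length-∷ʳ : ∀ (u : List A) x → length (u ∷ʳ x) ≡ suc (length u)
  length-∷ʳ u x = ≡.trans (length-++ u) (ℕₚ.+-comm _ 1)

-- Words and their values in the Coxeter group.

module Words (C : CoxeterSystem a c ℓ) where
  open import Data.Nat.Base using (_≤_; _<_)
  open CoxeterSystem C
  open IsCoxeterMatrix isCoxeterMatrix using (diagonal)
  open IsPresentedBy isPresentedBy using (presents)
  open Presentation (CoxeterRelator m) using (_⟶_; delete; Trivial; cancel; relator; _∼_)
  open Group W renaming (refl to ≈-refl; sym to ≈-sym; trans to ≈-trans)
  open GroupProperties W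
  open SetoidReasoning setoid

  ⟦_⟧ : List S → Carrier
  ⟦ α ⟧ = ⟨_⟩ C α

  ⟦++⟧ : ∀ α β → ⟦ α ++ β ⟧ ≈ ⟦ α ⟧ ∙ ⟦ β ⟧
  ⟦++⟧ []      β = ≈-sym (identityˡ _)
  ⟦++⟧ (s ∷ α) β = ≈-trans (∙-congˡ (⟦++⟧ α β)) (≈-sym (assoc _ _ _))

  eval-relator : ∀ s t {k} → m s t ≡ [ k ] →
    eval W σ (concat (replicate k ((Sign.+ , s) ∷ (Sign.+ , t) ∷ []))) ≈ ε
  eval-relator s t {k} eq = ≡.subst (λ v → eval W σ v ≈ ε) (++-identityʳ u)
    (Equivalence.from (presents (u ++ []) [])
      (return (delete [] [] (relator (power s t eq)))))
    where
    u : GroupWord S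
    u = concat (replicate k ((Sign.+ , s) ∷ (Sign.+ , t) ∷ []))

  -- As `m s s` is 1, the word s s is itself a relator.
  involutive : ∀ s → σ s ∙ σ s ≈ ε
  involutive s = ≈-trans (∙-congˡ (≈-sym (identityʳ _)))
    (eval-relator s s (Equivalence.from (diagonal s s) refl))

  σ⁻¹≈σ : ∀ s → σ s ⁻¹ ≈ σ s
  σ⁻¹≈σ s = ≈-sym (inverseˡ-unique _ _ (involutive s))

  cancelˡ : ∀ s x → σ s ∙ (σ s ∙ x) ≈ x
  cancelˡ s x = begin
    σ s ∙ (σ s ∙ x) ≈⟨ assoc _ _ _ ⟨
    σ s ∙ σ s ∙ x   ≈⟨ ∙-congʳ (involutive s) ⟩
    ε ∙ x           ≈⟨ identityˡ x ⟩
    x               ∎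

  cancelʳ : ∀ x s → x ∙ σ s ∙ σ s ≈ x
  cancelʳ x s = begin
    x ∙ σ s ∙ σ s   ≈⟨ assoc _ _ _ ⟩
    x ∙ (σ s ∙ σ s) ≈⟨ ∙-congˡ (involutive s) ⟩
    x ∙ ε           ≈⟨ identityʳ x ⟩
    x               ∎

  σ-swap : ∀ s {x y} → σ s ∙ x ≈ y → x ≈ σ s ∙ y
  σ-swap s eq = ≈-trans (≈-sym (cancelˡ s _)) (∙-congˡ eq)

  -- Reflections crossed by a word, counted modulo two.

  conj : S → Carrier → Carrier
  conj s t = σ s ∙ t ∙ σ s

  conj-cong : ∀ s {t t′} → t ≈ t′ → conj s t ≈ conj s t′
  conj-cong s eq = ∙-congʳ (∙-congˡ eq)

  σ∙conj : ∀ s t → σ s ∙ conj s t ≈ t ∙ σ s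
  σ∙conj s t = ≈-trans (∙-congˡ (assoc _ _ _)) (cancelˡ s _)

  conj∙σ : ∀ s t → conj s t ∙ σ s ≈ σ s ∙ t
  conj∙σ s t = cancelʳ _ s

  conj-self : ∀ s → conj s (σ s) ≈ σ s
  conj-self s = cancelʳ _ s

  -- This is ⟦α⟧⁻¹ t ⟦α⟧, formed letter by letter to follow the recursion of `Crossings`.
  conj* : List S → Carrier → Carrier
  conj* []      t = t
  conj* (s ∷ α) t = conj* α (conj s t)

  ⟦⟧∙conj* : ∀ α t → ⟦ α ⟧ ∙ conj* α t ≈ t ∙ ⟦ α ⟧
  ⟦⟧∙conj* []      t = ≈-trans (identityˡ _) (≈-sym (identityʳ _))
  ⟦⟧∙conj* (s ∷ α) t = begin
    σ s ∙ ⟦ α ⟧ ∙ conj* α (conj s t)   ≈⟨ assoc _ _ _ ⟩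
    σ s ∙ (⟦ α ⟧ ∙ conj* α (conj s t)) ≈⟨ ∙-congˡ (⟦⟧∙conj* α _) ⟩
    σ s ∙ (conj s t ∙ ⟦ α ⟧)           ≈⟨ assoc _ _ _ ⟨
    σ s ∙ conj s t ∙ ⟦ α ⟧             ≈⟨ ∙-congʳ (σ∙conj s t) ⟩
    t ∙ σ s ∙ ⟦ α ⟧                    ≈⟨ assoc _ _ _ ⟩
    t ∙ (σ s ∙ ⟦ α ⟧)                  ∎

  -- Decisions of which of the reflections s₁⋯sᵢ⋯s₁ of the word s₁⋯sₖ are
  -- equal to t.
  data Crossings (t : Carrier) : List S → Set (a ⊔ ℓ) where
    []  : Crossings t []
    _∷_ : ∀ {s α} → Dec (σ s ≈ t) → Crossings (conj s t) α → Crossings t (s ∷ α)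

  ¬¬Crossings : ∀ t α → ¬ ¬ Crossings t α
  ¬¬Crossings t []      k = k []
  ¬¬Crossings t (s ∷ α) k =
    ¬¬-excluded-middle λ d → ¬¬Crossings (conj s t) α λ ds → k (d ∷ ds)

  parity : ∀ {t α} → Crossings t α → Bool
  parity []       = false
  parity (d ∷ ds) = does d xor parity ds

  parity-unique : ∀ {t t′ α} → t ≈ t′ → (ds : Crossings t α) (es : Crossings t′ α) →
                  parity ds ≡ parity es
  parity-unique eq []       []       = refl
  parity-unique eq (d ∷ ds) (e ∷ es) = ≡.cong₂ _xor_
    (does-⇔ (mk⇔ (λ p → ≈-trans p eq) (λ p → ≈-trans p (≈-sym eq))) d e)
    (parity-unique (conj-cong _ eq) ds es)

  take : ∀ {t} α {β} → Crossings t (α ++ β) → Crossings t α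
  take []      ds       = []
  take (s ∷ α) (d ∷ ds) = d ∷ take α ds

  drop : ∀ {t} α {β} → Crossings t (α ++ β) → Crossings (conj* α t) β
  drop []      ds       = ds
  drop (s ∷ α) (d ∷ ds) = drop α ds

  parity-++ : ∀ {t} α {β} (ds : Crossings t (α ++ β)) →
              parity ds ≡ parity (take α ds) xor parity (drop α ds)
  parity-++ []      ds       = refl
  parity-++ (s ∷ α) (d ∷ ds) = ≡.trans
    (≡.cong (does d xor_) (parity-++ α ds))
    (≡.sym (Boolₚ.xor-assoc (does d) _ _))

  SameParity : List S → List S → Set (a ⊔ c ⊔ ℓ)
  SameParity α β = ∀ {t} (ds : Crossings t α) (es : Crossings t β) → parity ds ≡ parity es

  -- The crossings of the middle word exist only up to double negation; they may be used because
  -- equality of Booleans is decidable.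
  SameParity-trans : ∀ {α β γ} → SameParity α β → SameParity β γ → SameParity α γ
  SameParity-trans {β = β} p q {t} ds es = decidable-stable (_ Boolₚ.≟ _) λ k →
    ¬¬Crossings t β λ fs → k (≡.trans (p ds fs) (q fs es))

  -- Reflections in a power of a product of two generators.

  module Dihedral (s r : S) where

    power* : ℕ → List S
    power* k = concat (replicate k (s ∷ r ∷ []))

    infixr 7 sr∙_
    sr∙_ : Carrier → Carrier
    sr∙ x = σ s ∙ (σ r ∙ x)

    sr∙-cong : ∀ {x y} → x ≈ y → sr∙ x ≈ sr∙ y
    sr∙-cong eq = ∙-congˡ (∙-congˡ eq)

    orbit : ℕ → Carrier → List Carrier
    orbit zero    x = []
    orbit (suc k) x = x ∷ orbit k (sr∙ x)

    advance : ℕ → Carrier → Carrier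
    advance zero    x = x
    advance (suc k) x = advance k (sr∙ x)

    advance-sr : ∀ k x → advance k (sr∙ x) ≈ sr∙ advance k x
    advance-sr zero    x = ≈-refl
    advance-sr (suc k) x = advance-sr k (sr∙ x)

    advance-power : ∀ k x → advance k x ≈ ⟦ power* k ⟧ ∙ x
    advance-power zero    x = ≈-sym (identityˡ x)
    advance-power (suc k) x = begin
      advance k (sr∙ x)                   ≈⟨ advance-sr k x ⟩
      sr∙ advance k x                     ≈⟨ sr∙-cong (advance-power k x) ⟩
      σ s ∙ (σ r ∙ (⟦ power* k ⟧ ∙ x))    ≈⟨ ∙-congˡ (assoc _ _ _) ⟨
      σ s ∙ (σ r ∙ ⟦ power* k ⟧ ∙ x)      ≈⟨ assoc _ _ _ ⟨
      σ s ∙ (σ r ∙ ⟦ power* k ⟧) ∙ x      ∎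

    Hits : Carrier → List Carrier → Set (c ⊔ ℓ)
    Hits t = All (λ x → Dec (x ≈ t))

    ¬¬Hits : ∀ t xs → ¬ ¬ Hits t xs
    ¬¬Hits t []       k = k []
    ¬¬Hits t (x ∷ xs) k = ¬¬-excluded-middle λ d → ¬¬Hits t xs λ ds → k (d ∷ ds)

    parityʰ : ∀ {t xs} → Hits t xs → Bool
    parityʰ []       = false
    parityʰ (d ∷ ds) = does d xor parityʰ ds

    -- Left abstract in `R` to serve two purposes: `_≈_` compares the two halves of a periodic
    -- orbit, and conjugation by s r shifts an orbit in `parity-power`.
    parityʰ-unique : ∀ {t t′} (R : Carrier → Carrier → Set ℓ) →
      (∀ {x x′} → R x x′ → R (sr∙ x) (sr∙ x′)) →
      (∀ {x x′} → R x x′ → (x ≈ t) ⇔ (x′ ≈ t′)) →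
      ∀ k {x x′} → R x x′ → (ds : Hits t (orbit k x)) (es : Hits t′ (orbit k x′)) →
      parityʰ ds ≡ parityʰ es
    parityʰ-unique R step hit zero    rel []       []       = refl
    parityʰ-unique R step hit (suc k) rel (d ∷ ds) (e ∷ es) = ≡.cong₂ _xor_
      (does-⇔ (hit rel) d e) (parityʰ-unique R step hit k (step rel) ds es)

    split : ∀ {t} j k x (ds : Hits t (orbit (j + k) x)) →
            ∃[ es ] ∃[ fs ] parityʰ ds ≡
              parityʰ {t} {orbit j x} es xor parityʰ {t} {orbit k (advance j x)} fs
    split zero    k x ds       = [] , ds , refl
    split (suc j) k x (d ∷ ds) with split j k (sr∙ x) ds
    ... | es , fs , eq = d ∷ es , fs ,
      ≡.trans (≡.cong (does d xor_) eq) (≡.sym (Boolₚ.xor-assoc (does d) _ _))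

    -- As (s r)ᵏ = ε, the second half of the orbit starts again at `x` and hits `t` exactly as the
    -- first half does, so the two contributions cancel.
    periodic⇒even : ∀ k {n} → n ≡ k + k → ⟦ power* k ⟧ ≈ ε →
                    ∀ {t x} (ds : Hits t (orbit n x)) → parityʰ ds ≡ false
    periodic⇒even k refl period {t} {x} ds with split k k x ds
    ... | es , fs , eq = ≡.trans eq (≡.trans
      (≡.cong (_xor parityʰ fs)
        (parityʰ-unique _≈_ sr∙-cong
          (λ p → mk⇔ (≈-trans (≈-sym p)) (≈-trans p)) k
          (≈-trans (≈-sym (identityˡ x))
            (≈-trans (∙-congʳ (≈-sym period)) (≈-sym (advance-power k x))))
          es fs))
      (Boolₚ.xor-same (parityʰ fs)))

    -- The reflections of (s r)ᵏ are (s r)ⁱ s for i < 2k; when (s r)ᵏ = ε the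
    -- second half of this list repeats the first.
    parity-power : ∀ k {t} (ds : Crossings t (power* k)) (es : Hits t (orbit (k * 2) (σ s))) →
                   parity ds ≡ parityʰ es
    parity-power zero    []             []             = refl
    parity-power (suc k) {t} (d₁ ∷ d₂ ∷ ds) (e₁ ∷ e₂ ∷ es) =
      decidable-stable (_ Boolₚ.≟ _) λ neq →
      ¬¬Hits (conj r (conj s t)) (orbit (k * 2) (σ s)) λ fs →
      neq (≡.cong₂ _xor_ (does-⇔ (mk⇔ id id) d₁ e₁) (≡.cong₂ _xor_
        (does-⇔ (mk⇔ to from) d₂ e₂)
        (≡.trans (parity-power k ds fs) (≡.sym
          (parityʰ-unique Conjugate step hit (k * 2) base es fs)))))
      where
      to : σ r ≈ conj s t → sr∙ σ s ≈ t
      to eq = begin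
        σ s ∙ (σ r ∙ σ s)      ≈⟨ ∙-congˡ (∙-congʳ eq) ⟩
        σ s ∙ (conj s t ∙ σ s) ≈⟨ ∙-congˡ (conj∙σ s t) ⟩
        σ s ∙ (σ s ∙ t)        ≈⟨ cancelˡ s t ⟩
        t                      ∎

      from : sr∙ σ s ≈ t → σ r ≈ conj s t
      from eq = begin
        σ r                       ≈⟨ cancelʳ _ s ⟨
        σ r ∙ σ s ∙ σ s           ≈⟨ ∙-congʳ (cancelˡ s _) ⟨
        σ s ∙ (sr∙ σ s) ∙ σ s     ≈⟨ conj-cong s eq ⟩
        conj s t                  ∎

      -- Conjugation by s r, taking x to (s r)⁻¹ x (s r). It commutes with the step of the orbit and
      -- takes (s r)² s back to s. So the entries after the first two, tested against `t`, become
      -- the orbit from s tested against the conjugate of `t`, where the induction hypothesis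
      -- applies.
      Conjugate : Carrier → Carrier → Set ℓ
      Conjugate x x′ = conj r (conj s x) ≈ x′

      unconj : ∀ x → sr∙ conj r (conj s x) ≈ x ∙ σ s ∙ σ r
      unconj x = begin
        σ s ∙ (σ r ∙ conj r (conj s x)) ≈⟨ ∙-congˡ (σ∙conj r _) ⟩
        σ s ∙ (conj s x ∙ σ r)          ≈⟨ assoc _ _ _ ⟨
        σ s ∙ conj s x ∙ σ r            ≈⟨ ∙-congʳ (σ∙conj s x) ⟩
        x ∙ σ s ∙ σ r                   ∎

      hit : ∀ {x x′} → Conjugate x x′ → (x ≈ t) ⇔ (x′ ≈ conj r (conj s t))
      hit {x} {x′} rel = mk⇔
        (λ eq → ≈-trans (≈-sym rel) (conj-cong r (conj-cong s eq)))
        (λ eq → ∙-cancelʳ (σ s) _ _ (∙-cancelʳ (σ r) _ _ (begin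
          x ∙ σ s ∙ σ r            ≈⟨ unconj x ⟨
          sr∙ conj r (conj s x)    ≈⟨ sr∙-cong (≈-trans rel eq) ⟩
          sr∙ conj r (conj s t)    ≈⟨ unconj t ⟩
          t ∙ σ s ∙ σ r            ∎)))

      step : ∀ {x x′} → Conjugate x x′ → Conjugate (sr∙ x) (sr∙ x′)
      step {x} {x′} rel = begin
        σ r ∙ (σ s ∙ (sr∙ x) ∙ σ s) ∙ σ r ≈⟨ ∙-congʳ (∙-congˡ (∙-congʳ (cancelˡ s _))) ⟩
        σ r ∙ (σ r ∙ x ∙ σ s) ∙ σ r       ≈⟨ ∙-congʳ (∙-congˡ (assoc _ _ _)) ⟩
        σ r ∙ (σ r ∙ (x ∙ σ s)) ∙ σ r     ≈⟨ ∙-congʳ (cancelˡ r _) ⟩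
        x ∙ σ s ∙ σ r                     ≈⟨ unconj x ⟨
        sr∙ conj r (conj s x)             ≈⟨ sr∙-cong rel ⟩
        sr∙ x′                            ∎

      base : Conjugate (sr∙ sr∙ σ s) (σ s)
      base = begin
        conj r (conj s (sr∙ sr∙ σ s)) ≈⟨ step (step (conj-cong r (conj-self s))) ⟩
        sr∙ sr∙ conj r (σ s)          ≈⟨ sr∙-cong (∙-congˡ (σ∙conj r _)) ⟩
        sr∙ (σ s ∙ (σ s ∙ σ r))       ≈⟨ sr∙-cong (cancelˡ s _) ⟩
        sr∙ σ r                       ≈⟨ ∙-congˡ (involutive r) ⟩
        σ s ∙ ε                       ≈⟨ identityʳ _ ⟩
        σ s                           ∎

  -- Invariance of the parity under equality in the group.

  unsign : GroupWord S → List S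
  unsign = map proj₂

  ⟦unsign⟧ : ∀ u → ⟦ unsign u ⟧ ≈ eval W σ u
  ⟦unsign⟧ []                 = ≈-refl
  ⟦unsign⟧ ((Sign.+ , s) ∷ u) = ∙-congˡ (⟦unsign⟧ u)
  ⟦unsign⟧ ((Sign.- , s) ∷ u) = ∙-cong (≈-sym (σ⁻¹≈σ s)) (⟦unsign⟧ u)

  positive : List S → GroupWord S
  positive = map (Sign.+ ,_)

  unsign-positive : ∀ α → unsign (positive α) ≡ α
  unsign-positive α = ≡.trans (≡.sym (map-∘ α)) (map-id α)

  unsign-power : ∀ s t k →
    unsign (concat (replicate k ((Sign.+ , s) ∷ (Sign.+ , t) ∷ []))) ≡ Dihedral.power* s t k
  unsign-power s t zero    = refl
  unsign-power s t (suc k) = ≡.cong (λ u → s ∷ t ∷ u) (unsign-power s t k)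

  Trivial⇒≈ε : ∀ {u} → Trivial u → ⟦ unsign u ⟧ ≈ ε
  Trivial⇒≈ε (cancel x s)              = cancelˡ s ε
  Trivial⇒≈ε (relator {u} (power s t eq)) = ≈-trans (⟦unsign⟧ u) (eval-relator s t eq)

  -- In s s both reflections are s. In a relator (s t)ᵏ the 2k reflections form an orbit that
  -- repeats after k steps, so each occurs an even number of times.
  Trivial⇒even : ∀ {u} → Trivial u → SameParity (unsign u) []
  Trivial⇒even (cancel x s) (d ∷ e ∷ []) [] = ≡.trans
    (≡.cong₂ _xor_ (does-⇔ (mk⇔ to from) d e) (Boolₚ.xor-identityʳ _))
    (Boolₚ.xor-same (does e))
    where
    to : ∀ {t} → σ s ≈ t → σ s ≈ conj s t
    to eq = ≈-trans (≈-sym (conj-self s)) (conj-cong s eq)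

    from : ∀ {t} → σ s ≈ conj s t → σ s ≈ t
    from eq = ∙-cancelʳ (σ s) _ _ (≈-trans (∙-congˡ eq) (σ∙conj s _))
  Trivial⇒even (relator (power s t {k} eq)) = ≡.subst (λ u → SameParity u [])
    (≡.sym (unsign-power s t k)) even
    where
    open Dihedral s t

    even : SameParity (power* k) []
    even {x} ds [] = decidable-stable (_ Boolₚ.≟ _) λ neq →
      ¬¬Hits x (orbit (k * 2) (σ s)) λ es → neq (≡.trans (parity-power k ds es)
        (periodic⇒even k
          (≡.trans (ℕₚ.*-comm k 2) (≡.cong (k +_) (ℕₚ.+-identityʳ k)))
          (≡.subst (λ u → ⟦ u ⟧ ≈ ε) (unsign-power s t k)
            (Trivial⇒≈ε (relator (power s t eq))))
          es))

  -- Since `τ` has value ε, conjugation by it fixes the element carried on to `β`; hence `β` has the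
  -- same crossings with and without `τ`, and those inside `τ` cancel.
  delete-even : ∀ α τ β → ⟦ τ ⟧ ≈ ε → SameParity τ [] → SameParity (α ++ τ ++ β) (α ++ β)
  delete-even α τ β τ≈ε even {t} ds es = ≡.trans (parity-++ α ds) (≡.trans
    (≡.cong₂ _xor_ (parity-unique ≈-refl (take α ds) (take α es))
      (≡.trans (parity-++ τ (drop α ds)) (≡.cong₂ _xor_
        (even (take τ (drop α ds)) [])
        (parity-unique fixed (drop τ (drop α ds)) (drop α es)))))
    (≡.sym (parity-++ α es)))
    where
    fixed : conj* τ (conj* α t) ≈ conj* α t
    fixed = begin
      conj* τ (conj* α t)         ≈⟨ identityˡ _ ⟨
      ε ∙ conj* τ (conj* α t)     ≈⟨ ∙-congʳ τ≈ε ⟨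
      ⟦ τ ⟧ ∙ conj* τ (conj* α t) ≈⟨ ⟦⟧∙conj* τ _ ⟩
      conj* α t ∙ ⟦ τ ⟧           ≈⟨ ∙-congˡ τ≈ε ⟩
      conj* α t ∙ ε               ≈⟨ identityʳ _ ⟩
      conj* α t                   ∎

  ⟶⇒SameParity : ∀ {u v} → u ⟶ v → SameParity (unsign u) (unsign v)
  ⟶⇒SameParity (delete u {t} v triv)
    rewrite map-++ proj₂ u (t ++ v) | map-++ proj₂ t v | map-++ proj₂ u v =
    delete-even (unsign u) (unsign t) (unsign v) (Trivial⇒≈ε triv) (Trivial⇒even triv)

  ∼⇒SameParity : ∀ {u v} → u ∼ v → SameParity (unsign u) (unsign v)
  ∼⇒SameParity = fold {S = λ u v → SameParity (unsign u) (unsign v)} (record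
    { refl  = λ ds es → parity-unique ≈-refl ds es
    ; sym   = λ p ds es → ≡.sym (p es ds)
    ; trans = SameParity-trans
    }) ⟶⇒SameParity

  -- The presentation turns equality in W into a chain of insertions and deletions of trivial words,
  -- each of which preserves parity.
  ≈⇒SameParity : ∀ α β → ⟦ α ⟧ ≈ ⟦ β ⟧ → SameParity α β
  ≈⇒SameParity α β eq = ≡.subst₂ SameParity (unsign-positive α) (unsign-positive β)
    (∼⇒SameParity (Equivalence.to (presents (positive α) (positive β))
      (≈-trans (≈-sym (evalp α)) (≈-trans eq (evalp β)))))
    where
    evalp : ∀ α → ⟦ α ⟧ ≈ eval W σ (positive α)
    evalp α = ≡.subst (λ β → ⟦ β ⟧ ≈ eval W σ (positive α)) (unsign-positive α)
      (⟦unsign⟧ (positive α))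

  -- Odd parity forces a crossing. At the first one, `t` moved past the preceding letters becomes
  -- the generator that comes next and cancels it.
  odd⇒Deletion : ∀ {t} α (ds : Crossings t α) → parity ds ≡ true →
                 ∃[ β ] (Deletion β α × t ∙ ⟦ α ⟧ ≈ ⟦ β ⟧)
  odd⇒Deletion (s ∷ α) (yes p ∷ ds) _   =
    α , here , ≈-trans (∙-congʳ (≈-sym p)) (cancelˡ s _)
  odd⇒Deletion {t} (s ∷ α) (no _ ∷ ds) odd with odd⇒Deletion α ds odd
  ... | β , d , eq = s ∷ β , there d , (begin
    t ∙ (σ s ∙ ⟦ α ⟧)         ≈⟨ assoc _ _ _ ⟨
    t ∙ σ s ∙ ⟦ α ⟧           ≈⟨ ∙-congʳ (σ∙conj s t) ⟨
    σ s ∙ conj s t ∙ ⟦ α ⟧    ≈⟨ assoc _ _ _ ⟩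
    σ s ∙ (conj s t ∙ ⟦ α ⟧)  ≈⟨ ∙-congˡ eq ⟩
    σ s ∙ ⟦ β ⟧               ∎)

  -- Reduced words and exchange.

  Red : Pred (List S) (a ⊔ ℓ)
  Red α = ∀ β → ⟦ β ⟧ ≈ ⟦ α ⟧ → length α ≤ length β

  Red-stable : ∀ α → ¬ ¬ Red α → Red α
  Red-stable α ¬¬red β eq = decidable-stable (_ ℕₚ.≤? _) λ k → ¬¬red λ red → k (red β eq)

  ¬Red : ∀ α → ¬ Red α → ¬ ¬ (∃[ β ] (⟦ β ⟧ ≈ ⟦ α ⟧ × length β < length α))
  ¬Red α ¬red k = ¬red λ β eq → decidable-stable (_ ℕₚ.≤? _) λ α≰β →
    k (β , eq , ℕₚ.≰⇒> α≰β)

  ⟦insert⟧ : ∀ {t} p y q → t ∙ ⟦ p ⟧ ≈ ⟦ p ⟧ ∙ σ y →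
             t ∙ ⟦ p ++ q ⟧ ≈ ⟦ p ++ y ∷ q ⟧
  ⟦insert⟧ {t} p y q comm = begin
    t ∙ ⟦ p ++ q ⟧          ≈⟨ ∙-congˡ (⟦++⟧ p q) ⟩
    t ∙ (⟦ p ⟧ ∙ ⟦ q ⟧)     ≈⟨ assoc _ _ _ ⟨
    t ∙ ⟦ p ⟧ ∙ ⟦ q ⟧       ≈⟨ ∙-congʳ comm ⟩
    ⟦ p ⟧ ∙ σ y ∙ ⟦ q ⟧     ≈⟨ assoc _ _ _ ⟩
    ⟦ p ⟧ ∙ (σ y ∙ ⟦ q ⟧)   ≈⟨ ⟦++⟧ p (y ∷ q) ⟨
    ⟦ p ++ y ∷ q ⟧          ∎

  -- By the hypothesis `t` is the reflection p y p⁻¹, so the inserted `y` contributes one crossing.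
  -- Conjugation by `y` fixes `σ y`, so the crossings in `q` are unaffected.
  parity-insert : ∀ {t} p y q → t ∙ ⟦ p ⟧ ≈ ⟦ p ⟧ ∙ σ y →
                  (ds : Crossings t (p ++ y ∷ q)) (es : Crossings t (p ++ q)) →
                  parity ds ≡ not (parity es)
  parity-insert {t} p y q comm ds es
    rewrite parity-++ p ds | parity-++ p es | parity-unique ≈-refl (take p ds) (take p es)
    with drop p ds
  ... | d ∷ ds′ = ≡.trans (≡.cong (parity (take p es) xor_) (≡.cong₂ _xor_
      (dec-true d (≈-sym conj≈y))
      (parity-unique (≈-trans (conj-cong y conj≈y) (≈-trans (conj-self y) (≈-sym conj≈y)))
        ds′ (drop p es))))
    (≡.sym (Boolₚ.not-distribʳ-xor (parity (take p es)) _))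
    where
    conj≈y : conj* p t ≈ σ y
    conj≈y = ∙-cancelˡ ⟦ p ⟧ _ _ (≈-trans (⟦⟧∙conj* p t) comm)

  -- Let t = p y p⁻¹. Its parities in `p ++ q` and in `β` differ, so one of them is odd. If that of
  -- `p ++ q` is, deleting a letter there gives a word for ⟦β⟧ that is too short; otherwise the
  -- deletion takes place in `β`.
  strongExchange : ∀ p y q β → Red β → ⟦ p ++ y ∷ q ⟧ ≈ ⟦ β ⟧ →
                   length (p ++ q) ≤ length β →
                   ¬ ¬ (∃[ γ ] (Deletion γ β × ⟦ γ ⟧ ≈ ⟦ p ++ q ⟧))
  strongExchange p y q β red eq short k =
    ¬¬Crossings t (p ++ y ∷ q) λ ds →
    ¬¬Crossings t (p ++ q) λ es →
    ¬¬Crossings t β λ fs →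
    crossed es fs (≡.trans (≡.sym (≈⇒SameParity _ β eq ds fs)) (parity-insert p y q comm ds es))
    where
    t : Carrier
    t = ⟦ p ⟧ ∙ σ y ∙ ⟦ p ⟧ ⁻¹

    comm : t ∙ ⟦ p ⟧ ≈ ⟦ p ⟧ ∙ σ y
    comm = //-rightDividesˡ ⟦ p ⟧ (⟦ p ⟧ ∙ σ y)

    crossed : (es : Crossings t (p ++ q)) (fs : Crossings t β) → ¬ parity fs ≡ not (parity es)
    crossed es fs flip with parity es in pes
    ... | true  = case odd⇒Deletion (p ++ q) es pes of λ where
      (γ , d , eq′) → ℕₚ.<-irrefl refl (ℕₚ.≤-trans
        (≡.subst (suc (length β) ≤_) (Deletion-length d)
          (s≤s (red γ (≈-trans (≈-sym eq′) (≈-trans (⟦insert⟧ p y q comm) eq)))))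
        short)
    ... | false = case odd⇒Deletion β fs flip of λ where
      (γ , d , eq′) → k (γ , d , (begin
        ⟦ γ ⟧             ≈⟨ eq′ ⟨
        t ∙ ⟦ β ⟧         ≈⟨ ∙-congˡ eq ⟨
        t ∙ ⟦ p ++ y ∷ q ⟧ ≈⟨ ⟦insert⟧ p y (y ∷ q) comm ⟩
        ⟦ p ++ y ∷ y ∷ q ⟧ ≈⟨ ⟦++⟧ p _ ⟩
        ⟦ p ⟧ ∙ (σ y ∙ (σ y ∙ ⟦ q ⟧)) ≈⟨ ∙-congˡ (cancelˡ y _) ⟩
        ⟦ p ⟧ ∙ ⟦ q ⟧ ≈⟨ ⟦++⟧ p q ⟨
        ⟦ p ++ q ⟧        ∎))

  Red-[] : Red []
  Red-[] β _ = z≤n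

  Red-suffix : ∀ s α → Red (s ∷ α) → Red α
  Red-suffix s α red β eq = ℕₚ.≤-pred (red (s ∷ β) (∙-congˡ eq))

  Red-prefix : ∀ α {β} → Red (α ++ β) → Red α
  Red-prefix α {β} red γ eq = ℕₚ.+-cancelʳ-≤ (length β) _ _
    (≡.subst₂ _≤_ (length-++ α) (length-++ γ)
      (red (γ ++ β) (≈-trans (⟦++⟧ γ β) (≈-trans (∙-congʳ eq) (≈-sym (⟦++⟧ α β))))))

  -- A generator is not ε: the word s crosses the reflection s once, the empty word never.
  Red-singleton : ∀ s → Red (s ∷ [])
  Red-singleton s (_ ∷ _) _  = s≤s z≤n
  Red-singleton s []      eq = contradiction
    (≈⇒SameParity [] (s ∷ []) eq [] (yes ≈-refl ∷ [])) λ ()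

  Red-length : ∀ α β → Red α → Red β → ⟦ α ⟧ ≈ ⟦ β ⟧ → length α ≡ length β
  Red-length α β p q eq = ℕₚ.≤-antisym (p β (≈-sym eq)) (q α eq)

  Red-resp : ∀ α β → Red α → ⟦ β ⟧ ≈ ⟦ α ⟧ → length β ≡ length α → Red β
  Red-resp α β p eq len γ eq′ = ≡.subst (_≤ length γ) (≡.sym len) (p γ (≈-trans eq′ eq))

  -- A word `β` for s α that is shorter than `s ∷ α` makes `s ∷ β` a word for α, and strong exchange
  -- removes its first letter.
  exchange : ∀ s α → Red α → ¬ Red (s ∷ α) →
             ¬ ¬ (∃[ γ ] (Deletion γ α × ⟦ γ ⟧ ≈ σ s ∙ ⟦ α ⟧))
  exchange s α red ¬red k = ¬Red (s ∷ α) ¬red λ where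
    (β , eq , β<sα) → strongExchange [] s β α red
      (≈-trans (∙-congˡ eq) (cancelˡ s _)) (ℕₚ.≤-pred β<sα) λ where
        (γ , d , eq′) → k (γ , d , ≈-trans eq′ eq)

  ⟦++⟧-cancelʳ : ∀ α β γ → ⟦ α ++ γ ⟧ ≈ ⟦ β ++ γ ⟧ → ⟦ α ⟧ ≈ ⟦ β ⟧
  ⟦++⟧-cancelʳ α β γ eq = ∙-cancelʳ ⟦ γ ⟧ _ _
    (≈-trans (≈-sym (⟦++⟧ α γ)) (≈-trans eq (⟦++⟧ β γ)))

  ⟦∷ʳ⟧-swap : ∀ α β z → ⟦ α ∷ʳ z ⟧ ≈ ⟦ β ⟧ → ⟦ α ⟧ ≈ ⟦ β ∷ʳ z ⟧
  ⟦∷ʳ⟧-swap α β z eq = begin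
    ⟦ α ⟧                     ≈⟨ cancelʳ _ z ⟨
    ⟦ α ⟧ ∙ σ z ∙ σ z         ≈⟨ ∙-congʳ (⟦∷ʳ⟧ α) ⟨
    ⟦ α ∷ʳ z ⟧ ∙ σ z          ≈⟨ ∙-congʳ eq ⟩
    ⟦ β ⟧ ∙ σ z               ≈⟨ ⟦∷ʳ⟧ β ⟨
    ⟦ β ∷ʳ z ⟧                ∎
    where
    ⟦∷ʳ⟧ : ∀ α → ⟦ α ∷ʳ z ⟧ ≈ ⟦ α ⟧ ∙ σ z
    ⟦∷ʳ⟧ α = ≈-trans (⟦++⟧ α (z ∷ [])) (∙-congˡ (identityʳ _))

  -- The folding condition. Exchange writes r w z as w z with one letter deleted. Deleting a letter
  -- of `w` would, after cancelling `z`, give a word for r w that is too short; so `z` is deleted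
  -- and r w z = w.
  ¬Red-∷-∷ʳ : ∀ r w z → Red (r ∷ w) → Red (w ∷ʳ z) → ¬ Red (r ∷ w ∷ʳ z) →
              ¬ ¬ (⟦ w ∷ʳ z ⟧ ≈ ⟦ r ∷ w ⟧)
  ¬Red-∷-∷ʳ r w z rw wz ¬rwz k = exchange r (w ∷ʳ z) wz ¬rwz λ (γ , d , γ≈) →
    case Deletion-∷ʳ w d of λ where
      (inj₁ refl)            → k (σ-swap r (≈-sym γ≈))
      (inj₂ (δ , refl , d′)) → ℕₚ.1+n≰n (ℕₚ.≤-trans
        (ℕₚ.m≤n⇒m≤1+n (rw δ (⟦++⟧-cancelʳ δ (r ∷ w) (z ∷ []) γ≈)))
        (ℕₚ.≤-reflexive (Deletion-length d′)))

  -- Otherwise, strong exchange at `s` in r u s v would give r u v as a deletion of u s v z. If `z`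
  -- is deleted, then r u s = u, although r u s is reduced; if an earlier letter is, then r u v z
  -- has a word that is too short.
  Red-insert-∷ʳ : ∀ r u s v z → Red (r ∷ u ∷ʳ s) → Red (r ∷ (u ++ v) ∷ʳ z) →
                  Red ((u ++ s ∷ v) ∷ʳ z) →
                  ¬ (⟦ (u ++ s ∷ v) ∷ʳ z ⟧ ≈ ⟦ r ∷ u ++ s ∷ v ⟧)
  Red-insert-∷ʳ r u s v z rus ruvz usvz eq =
    strongExchange (r ∷ u) s v (w ∷ʳ z) usvz (≈-sym eq) short λ (γ , d , γ≈) →
    case Deletion-∷ʳ w d of λ where
      (inj₁ refl) → too-short u (≡.subst (λ n → suc n ≤ length u)
        (length-∷ʳ u s) (rus u (us≈ru γ≈)))
      (inj₂ (δ , refl , d′)) → too-short (u ++ v) (≡.subst₂ (λ n k → suc n ≤ k)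
        (length-∷ʳ (u ++ v) z)
        (ℕₚ.suc-injective (≡.trans (Deletion-length d′) (≡.sym ∣w∣)))
        (ruvz δ (⟦∷ʳ⟧-swap δ (r ∷ u ++ v) z γ≈)))
    where
    w : List S
    w = u ++ s ∷ v

    ∣w∣ : suc (length (u ++ v)) ≡ length w
    ∣w∣ = Deletion-length (Deletion-insert u)

    short : length (r ∷ u ++ v) ≤ length (w ∷ʳ z)
    short = ≡.subst₂ _≤_ (≡.sym ∣w∣) (≡.sym (length-∷ʳ w z)) (ℕₚ.n≤1+n _)

    too-short : ∀ (α : List S) → ¬ suc (suc (length α)) ≤ length α
    too-short α le = ℕₚ.1+n≰n (ℕₚ.≤-trans (ℕₚ.n≤1+n _) le)

    us≈ru : ⟦ w ⟧ ≈ ⟦ r ∷ u ++ v ⟧ → ⟦ u ⟧ ≈ ⟦ r ∷ u ∷ʳ s ⟧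
    us≈ru eq = σ-swap r (≈-sym (⟦++⟧-cancelʳ (u ∷ʳ s) (r ∷ u) v
      (≡.subst (λ α → ⟦ α ⟧ ≈ ⟦ r ∷ u ++ v ⟧) (≡.sym (++-assoc u (s ∷ []) v)) eq)))

  -- Induction on `v` from the right. When `z` is appended, the folding condition leaves one
  -- obstruction, which `Red-insert-∷ʳ` excludes.
  Red-insert : ∀ r u s v → Red (r ∷ u ∷ʳ s) → Red (r ∷ u ++ v) →
               Red (u ++ s ∷ v) → Red (r ∷ u ++ s ∷ v)
  Red-insert r u s v rus ruv usv = go (reverseView v) ruv usv
    where
    go : ∀ {v} → Reverse v → Red (r ∷ u ++ v) → Red (u ++ s ∷ v) → Red (r ∷ u ++ s ∷ v)
    go []              ruv  usv  = rus
    go (v ∶ rv ∶ʳ z) ruvz usvz = ≡.subst (Red ∘ (r ∷_)) assoc-z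
      (Red-stable (r ∷ (u ++ s ∷ v) ∷ʳ z) λ ¬red →
      ¬Red-∷-∷ʳ r (u ++ s ∷ v) z
        (go rv (Red-prefix (r ∷ u ++ v) ruvz′) (Red-prefix (u ++ s ∷ v) usvz′))
        usvz′ ¬red (Red-insert-∷ʳ r u s v z rus ruvz′ usvz′))
      where
      assoc-z : (u ++ s ∷ v) ∷ʳ z ≡ u ++ s ∷ v ∷ʳ z
      assoc-z = ++-assoc u (s ∷ v) _

      usvz′ : Red ((u ++ s ∷ v) ∷ʳ z)
      usvz′ = ≡.subst Red (≡.sym assoc-z) usvz

      ruvz′ : Red (r ∷ (u ++ v) ∷ʳ z)
      ruvz′ = ≡.subst (Red ∘ (r ∷_)) (≡.sym (++-assoc u v _)) ruvz

-- Lexicographic order, truncation and subwords.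

∈-symmetricDifference-∷ : ∀ b {A B : Subset n} {i} →
  i ∈ (((b ∷ A) ∪ (b ∷ B)) ─ ((b ∷ A) ∩ (b ∷ B))) →
  ∃[ j ] (i ≡ suc j × j ∈ ((A ∪ B) ─ (A ∩ B)))
∈-symmetricDifference-∷ false (there p) = _ , refl , p
∈-symmetricDifference-∷ true  (there p) = _ , refl , p

∷-≤lex : ∀ b {A B : Subset n} → A ≤lex B → (b ∷ A) ≤lex (b ∷ B)
∷-≤lex b (inj₁ refl)                   = inj₁ refl
∷-≤lex b {A} {B} (inj₂ (i , (i∈ , least) , i∈A)) = inj₂ (suc i , (there i∈ , least′) , there i∈A)
  where
  least′ : ∀ j → j ∈ (((b ∷ A) ∪ (b ∷ B)) ─ ((b ∷ A) ∩ (b ∷ B))) → suc i Fin.≤ j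
  least′ j j∈ with ∈-symmetricDifference-∷ b {A} {B} j∈
  ... | k , refl , k∈ = s≤s (least k k∈)

∷-≤lex⁻¹ : ∀ b {A B : Subset n} → (b ∷ A) ≤lex (b ∷ B) → A ≤lex B
∷-≤lex⁻¹ b (inj₁ eq)                      = inj₁ (Vecₚ.∷-injectiveʳ eq)
∷-≤lex⁻¹ b {A} {B} (inj₂ (i , (i∈ , least) , i∈A)) with ∈-symmetricDifference-∷ b {A} {B} i∈
... | j , refl , j∈ = inj₂ (j ,
  (j∈ , λ k k∈ → ℕₚ.≤-pred (least (suc k) (there k∈))) , Subsetₚ.drop-there i∈A)

true≤lexfalse : ∀ {A B : Subset n} → (true ∷ A) ≤lex (false ∷ B)
true≤lexfalse = inj₂ (zero , (here , λ _ _ → z≤n) , here)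

false≰lextrue : ∀ {A B : Subset n} → ¬ (false ∷ A) ≤lex (true ∷ B)
false≰lextrue (inj₂ (suc i , (_ , least) , _)) with least zero here
... | ()

upTo : Subset n → Fin n → Subset n
upTo (b ∷ B) zero    = b ∷ ⊥
upTo (b ∷ B) (suc x) = b ∷ upTo B x

-- All elements of `B` before `x` lie in `A`, so adjoining the truncation of `B`, which includes
-- position `x`, adds `x` alone.
least-difference : ∀ (A B : Subset n) → B ⊈ A →
  ∃[ x ] (IsLeast Fin._≤_ (_∈ (B ─ A)) x × A ∪ upTo B x ≡ A ∪ ⁅ x ⁆)
least-difference []          []          B⊈A = ⊥-elim (B⊈A λ ())
least-difference (false ∷ A) (true ∷ B)  B⊈A = zero , (here , λ _ _ → z≤n) , refl
least-difference (true ∷ A)  (b ∷ B)     B⊈A with least-difference A B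
  (λ B⊆A → B⊈A λ { here → here ; (there p) → there (B⊆A p) })
... | x , (x∈ , least) , eq = suc x ,
  (there x∈ , λ { (suc y) (there y∈) → s≤s (least y y∈) }) , ≡.cong (true ∷_) eq
least-difference (false ∷ A) (false ∷ B) B⊈A with least-difference A B
  (λ B⊆A → B⊈A λ { (there p) → there (B⊆A p) })
... | x , (x∈ , least) , eq = suc x ,
  (there x∈ , λ { (suc y) (there y∈) → s≤s (least y y∈) }) , ≡.cong (false ∷_) eq

subword-⊥ : ∀ {S : Set a} (ω : Vec S n) → subword ω ⊥ ≡ []
subword-⊥ []      = refl
subword-⊥ (s ∷ ω) = subword-⊥ ω

subword-upTo : ∀ {S : Set a} (ω : Vec S n) A x →
               ∃[ v ] (subword ω A ≡ subword ω (upTo A x) ++ v)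
subword-upTo (s ∷ ω) (true  ∷ A) zero    rewrite subword-⊥ ω = subword ω A , refl
subword-upTo (s ∷ ω) (false ∷ A) zero    rewrite subword-⊥ ω = subword ω A , refl
subword-upTo (s ∷ ω) (true  ∷ A) (suc x) with subword-upTo ω A x
... | v , eq = v , ≡.cong (s ∷_) eq
subword-upTo (s ∷ ω) (false ∷ A) (suc x) = subword-upTo ω A x

-- Words obtained by exchange thus come from index sets again and can compete for lexicographic
-- minimality.
Deletion-subword : ∀ {S : Set a} (ω : Vec S n) A {u} → Deletion u (subword ω A) →
                   ∃[ B ] (subword ω B ≡ u)
Deletion-subword []      []          ()
Deletion-subword (s ∷ ω) (true  ∷ A) here      = false ∷ A , refl
Deletion-subword (s ∷ ω) (true  ∷ A) (there d) with Deletion-subword ω A d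
... | B , eq = true ∷ B , ≡.cong (s ∷_) eq
Deletion-subword (s ∷ ω) (false ∷ A) d         with Deletion-subword ω A d
... | B , eq = false ∷ B , eq

zipWith-left : ∀ (A B : Subset n) → Vec.zipWith (λ x y → x) A B ≡ A
zipWith-left []      []      = refl
zipWith-left (x ∷ A) (_ ∷ B) = ≡.cong (x ∷_) (zipWith-left A B)

zipWith-right : ∀ (A B : Subset n) → Vec.zipWith (λ x y → y) A B ≡ B
zipWith-right []      []      = refl
zipWith-right (_ ∷ A) (y ∷ B) = ≡.cong (y ∷_) (zipWith-right A B)

-- Sorted subwords, their local description and their unions.

module SortedWords (C : CoxeterSystem a c ℓ) where
  open import Data.Nat.Base using (_≤_)
  open CoxeterSystem C
  open Group W using (_≈_; _∙_; ∙-congˡ) renaming (refl to ≈-refl; sym to ≈-sym; trans to ≈-trans)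
  open GroupProperties W using (∙-cancelˡ)
  open Words C
  open GreedyUnion Red Red-[] Red-prefix (λ s {α} → Red-suffix s α) Red-insert

  Reduced⇒Red : ∀ α → Reduced C α → Red α
  Reduced⇒Red α (_ , least) β eq = least (length β) (β , refl , eq)

  Red⇒Reduced : ∀ α → Red α → Reduced C α
  Red⇒Reduced α red = (α , refl , ≈-refl) , λ { _ (β , refl , eq) → red β eq }

  LocallySorted : Vec S n → Subset n → Set (a ⊔ ℓ)
  LocallySorted []      []      = ⊤
  LocallySorted (s ∷ ω) (_ ∷ A) = Red (s ∷ subword ω A) × LocallySorted ω A

  LocallySorted⇒Red : ∀ (ω : Vec S n) A → LocallySorted ω A → Red (subword ω A)
  LocallySorted⇒Red []      []          _       = Red-[]
  LocallySorted⇒Red (s ∷ ω) (true  ∷ A) (p , _) = p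
  LocallySorted⇒Red (s ∷ ω) (false ∷ A) (p , _) = Red-suffix s (subword ω A) p

  -- The critical case is that `A` omits `s` and `B` takes it. Then s A and the rest of `B` have
  -- equal values, so the rest of `B` is longer than `A`; but `A` has the length of all of `B`,
  -- since both are reduced.
  LocallySorted⇒≤lex : ∀ (ω : Vec S n) A B → LocallySorted ω A → Red (subword ω B) →
                       ⟦ subword ω B ⟧ ≈ ⟦ subword ω A ⟧ → A ≤lex B
  LocallySorted⇒≤lex []      []          []          _       _ _  = inj₁ refl
  LocallySorted⇒≤lex (s ∷ ω) (true  ∷ A) (true  ∷ B) (_ , l) q eq =
    ∷-≤lex true (LocallySorted⇒≤lex ω A B l (Red-suffix s (subword ω B) q) (∙-cancelˡ (σ s) _ _ eq))
  LocallySorted⇒≤lex (s ∷ ω) (false ∷ A) (false ∷ B) (_ , l) q eq =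
    ∷-≤lex false (LocallySorted⇒≤lex ω A B l q eq)
  LocallySorted⇒≤lex (s ∷ ω) (true  ∷ A) (false ∷ B) _       _ _  = true≤lexfalse
  LocallySorted⇒≤lex (s ∷ ω) (false ∷ A) (true  ∷ B) (p , l) q eq = contradiction
    (ℕₚ.≤-trans (ℕₚ.n≤1+n _) (≡.subst (λ k → suc k ≤ length (subword ω B))
      (Red-length (subword ω A) (s ∷ subword ω B) (Red-suffix s (subword ω A) p) q (≈-sym eq))
      (p (subword ω B) (σ-swap s eq)))) ℕₚ.1+n≰n

  LocallySorted⇒Sorted : ∀ (ω : Vec S n) A → LocallySorted ω A → Sorted C ω A
  LocallySorted⇒Sorted ω A l = reduced , (reduced , ≈-refl) ,
    λ B (q , eq) → LocallySorted⇒≤lex ω A B l (Reduced⇒Red (subword ω B) q) eq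
    where
    reduced : Reduced C (subword ω A)
    reduced = Red⇒Reduced (subword ω A) (LocallySorted⇒Red ω A l)

  Minimal : Vec S n → Subset n → Set _
  Minimal ω A = ∀ B → Red (subword ω B) → ⟦ subword ω B ⟧ ≈ ⟦ subword ω A ⟧ → A ≤lex B

  -- If `s` is omitted and s A is not reduced, exchange trades a letter of `A` for a leading `s`.
  -- The result is a reduced word for the same element that is lexicographically smaller.
  Minimal⇒LocallySorted : ∀ (ω : Vec S n) A → Red (subword ω A) → Minimal ω A → LocallySorted ω A
  Minimal⇒LocallySorted []      []          p minimal = tt
  Minimal⇒LocallySorted (s ∷ ω) (true  ∷ A) p minimal = p ,
    Minimal⇒LocallySorted ω A (Red-suffix s (subword ω A) p) λ B q eq →
      ∷-≤lex⁻¹ true (minimal (true ∷ B)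
        (Red-resp (s ∷ subword ω A) (s ∷ subword ω B) p (∙-congˡ eq)
          (≡.cong suc (Red-length (subword ω B) (subword ω A) q (Red-suffix s (subword ω A) p) eq)))
        (∙-congˡ eq))
  Minimal⇒LocallySorted (s ∷ ω) (false ∷ A) p minimal =
    Red-stable (s ∷ subword ω A) (λ ¬red → exchange s (subword ω A) p ¬red λ (γ , d , γ≈) →
      case Deletion-subword ω A d of λ where
        (B , refl) → false≰lextrue (minimal (true ∷ B)
          (Red-resp (subword ω A) (s ∷ subword ω B) p
            (≈-sym (σ-swap s (≈-sym γ≈))) (Deletion-length d))
          (≈-sym (σ-swap s (≈-sym γ≈))))) ,
    Minimal⇒LocallySorted ω A p λ B q eq → ∷-≤lex⁻¹ false (minimal (false ∷ B) q eq)

  Sorted⇒LocallySorted : ∀ (ω : Vec S n) A → Sorted C ω A → LocallySorted ω A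
  Sorted⇒LocallySorted ω A (p , _ , minimal) =
    Minimal⇒LocallySorted ω A (Reduced⇒Red (subword ω A) p) λ B q eq →
      minimal B (Red⇒Reduced (subword ω B) q , eq)

  LocallySorted-⊥ : ∀ (ω : Vec S n) → LocallySorted ω ⊥
  LocallySorted-⊥ []      = tt
  LocallySorted-⊥ (s ∷ ω) =
    ≡.subst (Red ∘ (s ∷_)) (≡.sym (subword-⊥ ω)) (Red-singleton s) , LocallySorted-⊥ ω

  LocallySorted-upTo : ∀ (ω : Vec S n) A x → LocallySorted ω A → LocallySorted ω (upTo A x)
  -- The condition at `s` is the same for either value of `b`, so the proof for `⊥` proves it for
  -- `b ∷ ⊥`.
  LocallySorted-upTo (s ∷ ω) (b ∷ A) zero    _       = LocallySorted-⊥ (s ∷ ω)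
  LocallySorted-upTo (s ∷ ω) (b ∷ A) (suc x) (p , l) with subword-upTo ω A x
  ... | v , eq = Red-prefix (s ∷ subword ω (upTo A x)) (≡.subst (Red ∘ (s ∷_)) eq p) ,
    LocallySorted-upTo ω A x l

  mark : Vec S n → Subset n → Subset n → Marked
  mark []      []      []      = []
  mark (s ∷ ω) (x ∷ A) (y ∷ B) = (s , x , y) ∷ mark ω A B

  select-mark : ∀ f (ω : Vec S n) A B → select f (mark ω A B) ≡ subword ω (Vec.zipWith f A B)
  select-mark f []      []      []      = refl
  select-mark f (s ∷ ω) (x ∷ A) (y ∷ B) with f x y
  ... | true  = ≡.cong (s ∷_) (select-mark f ω A B)
  ... | false = select-mark f ω A B

  Greedy-mark : ∀ f (ω : Vec S n) A B →
    LocallySorted ω (Vec.zipWith f A B) → Greedy f (mark ω A B)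
  Greedy-mark f []      []      []      _       = tt
  Greedy-mark f (s ∷ ω) (x ∷ A) (y ∷ B) (p , l) =
    ≡.subst (Red ∘ (s ∷_)) (≡.sym (select-mark f ω A B)) p , Greedy-mark f ω A B l

  Greedy-mark⁻¹ : ∀ f (ω : Vec S n) A B →
    Greedy f (mark ω A B) → LocallySorted ω (Vec.zipWith f A B)
  Greedy-mark⁻¹ f []      []      []      _       = tt
  Greedy-mark⁻¹ f (s ∷ ω) (x ∷ A) (y ∷ B) (p , l) =
    ≡.subst (Red ∘ (s ∷_)) (select-mark f ω A B) p , Greedy-mark⁻¹ f ω A B l

  LocallySorted-∪ : ∀ (ω : Vec S n) A B →
    LocallySorted ω A → LocallySorted ω B → LocallySorted ω (A ∪ B)
  LocallySorted-∪ ω A B p q = Greedy-mark⁻¹ _∨_ ω A B (union-closed _ _ ℕₚ.≤-refl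
    -- `A ∪ B` is by definition `Vec.zipWith _∨_ A B`; `A` and `B` are brought to the same form with
    -- the two projections.
    (Greedy-mark left ω A B (≡.subst (LocallySorted ω) (≡.sym (zipWith-left A B)) p))
    (Greedy-mark right ω A B (≡.subst (LocallySorted ω) (≡.sym (zipWith-right A B)) q)))

open import Data.Fin.Base using (_≤_)

theorem4p4 : ∀ {a c ℓ : Level} (C : CoxeterSystem a c ℓ) {n : ℕ}
    (ω : Vec (CoxeterSystem.S C) n) →
    IsSupersolvableAntimatroid _≤_ (Sorted C ω)
theorem4p4 C ω = record
  { isTotalOrder = Finₚ.≤-isTotalOrder
  ; ∅-feasible   = LocallySorted⇒Sorted ω ⊥ (LocallySorted-⊥ ω)
  ; extension    = λ {A} {B} p q B⊈A → case least-difference A B B⊈A of λ where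
      (x , least , eq) → x , least , ≡.subst (Sorted C ω) eq
        (LocallySorted⇒Sorted ω (A ∪ upTo B x)
          (LocallySorted-∪ ω A (upTo B x) (Sorted⇒LocallySorted ω A p)
            (LocallySorted-upTo ω B x (Sorted⇒LocallySorted ω B q))))
  }
  where open SortedWords C
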